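{- Let $d\ge 1$ and let $k_1,\dots,k_d$ be integers such that $k_i\ge 2$ is even for every $i<d$ and $k_d\ge 3$. Let $f$ be the function on $n=2\sum_{i=1}^d k_i$ variables defined in the context. Then $\deg_{\pm}(f)=d$ and $$W(f,d)\ \ge\ 2^{(k_d-2)\prod_{i=1}^{d-1}k_i\ -\ d}.$$
   Context: Boolean functions are maps $\{0,1\}^n\to\{0,1\}$; $\mathrm{sgn}(t)=1$ if $t\ge 0$ and $\mathrm{sgn}(t)=0$ otherwise. A threshold gate for $f$ is an integer-coefficient polynomial $p$ with $f(x)=\mathrm{sgn}(p(x))$ for all $x\in\{0,1\}^n$; its weight is the sum of absolute values of its coefficients. $\deg_{\pm}(f)$ is the minimal degree of a threshold gate for $f$, and for $d\ge\deg_{\pm}(f)$, $W(f,d)$ is the minimal weight of a threshold gate for $f$ of degree at most $d$. The function $f$: the input is $(x^1,\dots,x^d,y^1,\dots,y^d)$ with $x^i=(x^i_1,\dots,x^i_{k_i}),\ y^i=(y^i_1,\dots,y^i_{k_i})\in\{0,1\}^{k_i}$. For a positive integer $k$ and $[k]=\{1,\dots,k\}$, let $<_1$ be the order $1,2,\dots,k$ and $<_0$ the reverse order $k,k-1,\dots,1$ (listed from smallest to largest); let $\mathrm{num}_1(j)=j$ and $\mathrm{num}_0(j)=k-j+1$ be the position of $j$ in these orders. Let $K=[k_1]\times\dots\times[k_d]$. To each $\alpha=(\alpha_1,\dots,\alpha_d)\in K$ associate indices $i_1(\alpha)=1$ and $i_{l+1}(\alpha)=\mathrm{num}_{i_l(\alpha)}(\alpha_l)\bmod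 2$ (computed in $[k_l]$). Order $K$ as follows: for $\alpha\ne\beta$ let $l$ be the least index with $\alpha_l\ne\beta_l$ (then $i_l(\alpha)=i_l(\beta)$); declare $\alpha<\beta$ iff $\alpha_l$ precedes $\beta_l$ in the order $<_{i_l(\alpha)}$ on $[k_l]$. Let $\alpha$ be the largest element of $K$ in this order with $\prod_{i=1}^d(x^i_{\alpha_i}-y^i_{\alpha_i})\ne 0$; then $f(x,y)=\mathrm{sgn}\prod_{i=1}^d(x^i_{\alpha_i}-y^i_{\alpha_i})$. If no such $\alpha$ exists, $f(x,y)=1$. -}

module Defs where

open import Data.Bool using (Bool; true; false; if_then_else_)
open import Data.Nat as ℕ using (ℕ; zero; suc; _∸_; _⊔_)
open import Data.Nat.Divisibility using (_∣_)
open import Data.Integer as ℤ using (ℤ; +_; -[1+_]; ∣_∣)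
open import Data.Fin as Fin using (Fin; toℕ; inject₁; fromℕ)
open import Data.List using (List; []; _∷_; length; map)
open import Data.Product using (Σ; _×_; _,_; ∃)
open import Data.Sum using (_⊎_)
open import Relation.Binary.PropositionalEquality using (_≡_)
open import Relation.Nullary using (¬_)

-- Generic integer polynomials over a set of variables V, on {0,1}^V.
-- A monomial is a list of variables (repetitions allowed, so x^2 = [x,x]);
-- a polynomial is a finite list of (coefficient, monomial) terms.

Monomial : Set → Set
Monomial V = List V

Poly : Set → Set
Poly V = List (ℤ × Monomial V)

b2z : Bool → ℤ
b2z true  = + 1
b2z false = + 0

sgn : ℤ → Bool
sgn (+ _)    = true
sgn -[1+ _ ] = false

evalMono : {V : Set} → (V → Bool) → Monomial V → ℤ
evalMono a []      = + 1
evalMono a (v ∷ m) = b2z (a v) ℤ.* evalMono a m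

eval : {V : Set} → Poly V → (V → Bool) → ℤ
eval []            a = + 0
eval ((c , m) ∷ p) a = c ℤ.* evalMono a m ℤ.+ eval p a

degree : {V : Set} → Poly V → ℕ
degree []                 = 0
degree ((+ 0 , m) ∷ p)    = degree p
degree ((+ suc _ , m) ∷ p) = length m ⊔ degree p
degree ((-[1+ _ ] , m) ∷ p) = length m ⊔ degree p

weight : {V : Set} → Poly V → ℕ
weight []            = 0
weight ((c , m) ∷ p) = ∣ c ∣ ℕ.+ weight p

-- A Boolean function is given as its graph R a b  ("f(a) = b").
-- p is a threshold gate for f.
IsThresholdGate : {V : Set} → ((V → Bool) → Bool → Set) → Poly V → Set
IsThresholdGate {V} R p = (a : V → Bool) (b : Bool) → R a b → sgn (eval p a) ≡ b

SignDegreeIs : {V : Set} → ((V → Bool) → Bool → Set) → ℕ → Set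
SignDegreeIs {V} R d =
  (Σ (Poly V) λ p → IsThresholdGate R p × degree p ℕ.≤ d)
  × ((p : Poly V) → IsThresholdGate R p → d ℕ.≤ degree p)

WeightAtLeast : {V : Set} → ((V → Bool) → Bool → Set) → ℕ → ℕ → Set
WeightAtLeast {V} R d B =
  (p : Poly V) → IsThresholdGate R p → degree p ℕ.≤ d → B ℕ.≤ weight p

-- Variables: (true , (i , j)) is x^i_{j+1}, (false , (i , j)) is y^i_{j+1}
-- (i : Fin d is the 0-based block index, j : Fin (k i) the 0-based position).
Var : (d : ℕ) → (Fin d → ℕ) → Set
Var d k = Bool × Σ (Fin d) (λ i → Fin (k i))

-- K = [k_1] × ... × [k_d]   (α i = j means α_{i+1} = j+1)
K : (d : ℕ) → (Fin d → ℕ) → Set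
K d k = (i : Fin d) → Fin (k i)

-- num_s(j) for j ∈ [k]  (j given 0-based as Fin k); s = true is order <_1
num : Bool → (k : ℕ) → Fin k → ℕ
num true  k j = suc (toℕ j)
num false k j = k ∸ toℕ j

parity : ℕ → Bool
parity zero          = false
parity (suc zero)    = true
parity (suc (suc n)) = parity n

-- indFrom s α l : the index i_{l+1} given that the first index equals s
indFrom : {d : ℕ} {k : Fin d → ℕ} → Bool → K d k → Fin d → Bool
indFrom s α Fin.zero    = s
indFrom {suc d} {k} s α (Fin.suc l) =
  indFrom {d} {λ i → k (Fin.suc i)}
    (parity (num s (k Fin.zero) (α Fin.zero))) (λ i → α (Fin.suc i)) l

-- ind α l = i_{l+1}(α)   (i_1(α) = 1)
ind : {d : ℕ} {k : Fin d → ℕ} → K d k → Fin d → Bool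
ind α l = indFrom true α l

Precedes : {k : ℕ} → Bool → Fin k → Fin k → Set
Precedes true  j j' = toℕ j ℕ.< toℕ j'
Precedes false j j' = toℕ j' ℕ.< toℕ j

_<K_ : {d : ℕ} {k : Fin d → ℕ} → K d k → K d k → Set
_<K_ {d} α β = Σ (Fin d) λ l →
  ((m : Fin d) → m Fin.< l → α m ≡ β m) × Precedes (ind α l) (α l) (β l)

_≤K_ : {d : ℕ} {k : Fin d → ℕ} → K d k → K d k → Set
α ≤K β = ((l : _) → α l ≡ β l) ⊎ (α <K β)

prodDiff : (d : ℕ) (k : Fin d → ℕ) → (Var d k → Bool) → K d k → ℤ
prodDiff zero    k a α = + 1
prodDiff (suc d) k a α =
  (b2z (a (true , Fin.zero , α Fin.zero)) ℤ.- b2z (a (false , Fin.zero , α Fin.zero)))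
  ℤ.* prodDiff d (λ i → k (Fin.suc i))
        (λ { (s , i , j) → a (s , Fin.suc i , j) }) (λ i → α (Fin.suc i))

IsLargestNonzero : (d : ℕ) (k : Fin d → ℕ) → (Var d k → Bool) → K d k → Set
IsLargestNonzero d k a α =
  ¬ (prodDiff d k a α ≡ + 0)
  × ((β : K d k) → ¬ (prodDiff d k a β ≡ + 0) → β ≤K α)

F : (d : ℕ) (k : Fin d → ℕ) → (Var d k → Bool) → Bool → Set
F d k a b =
  (Σ (K d k) λ α → IsLargestNonzero d k a α × b ≡ sgn (prodDiff d k a α))
  ⊎ (((α : K d k) → prodDiff d k a α ≡ + 0) × b ≡ true)

prodFin : (n : ℕ) → (Fin n → ℕ) → ℕ
prodFin zero    g = 1
prodFin (suc n) g = g Fin.zero ℕ.* prodFin n (λ i → g (Fin.suc i))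

{-# OPTIONS --safe #-}
module Submission where

-- Upper bound on the degree: run through K in increasing order and add each product of differences
-- with a coefficient exceeding the weight of everything added before.
--
-- Lower bounds: let p be a threshold gate of degree ≤ d, and sum the values of p over the 2^d ways
-- of swapping xⁱ with yⁱ in some blocks i, with alternating signs.  Monomials missing a block
-- cancel, so what remains is a form Q that is linear in each difference xⁱ − yⁱ (and Q = 0 if
-- deg p < d), while |Q| ≤ 2^d · weight p.  Swapping a block flips f, so Q is strictly positive
-- wherever the leading product is +1.  Let w be the value of Q at unit vectors, indexed by K.
-- Within a run of the last coordinate each w exceeds the sum of the previous ones, so it grows by
-- 2^(k_d−2); because the order on K is boustrophedon and the other kᵢ are even, the next run starts
-- at a neighbour differing in one other coordinate, where w is larger still.  Hence
-- w ≥ 2^((k_d−2)∏kᵢ) at the largest element of K.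

open import Defs
open import Data.Nat using (ℕ; suc; _≤_; _<_; _*_; _∸_; _^_)
open import Data.Nat.Divisibility using (_∣_)
open import Data.Fin using (Fin; toℕ; fromℕ; inject₁)
open import Data.Product using (_×_)
open import Data.Bool using (Bool; true; false; not; _xor_)
open import Data.Empty using (⊥-elim)
open import Data.Fin using (opposite; fromℕ<)
open import Data.Fin.Properties using (opposite-prop; opposite-involutive; toℕ-fromℕ<; toℕ<n; toℕ-injective)
open import Data.Integer as ℤ using (ℤ; +_; -[1+_]; ∣_∣)
open import Data.Integer.Tactic.RingSolver using (solve-∀)
open import Data.List using ([]; _∷_; _++_; length; map)
open import Data.List.Properties using (length-map)
open import Data.List.Relation.Unary.All as All using (All; []; _∷_)
open import Data.List.Relation.Unary.All.Properties using (++⁺; map⁺)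
open import Data.Nat using (zero; z≤n; s≤s; _+_; _≤ᵇ_)
open import Data.Nat.Divisibility using (divides)
open import Data.Product using (Σ; _,_; proj₁; proj₂)
open import Data.Sum using (_⊎_; inj₁; inj₂)
open import Data.Unit using (⊤; tt)
open import Data.Vec using (Vec; []; _∷_)
open import Function using (_∘_)
open import Relation.Binary.PropositionalEquality
open import Relation.Nullary using (¬_; Dec; yes; no; does; ofʸ; ofⁿ; contradiction)
import Data.Fin.Properties as Finₚ
import Data.Integer.Properties as ℤₚ
import Data.Nat.Properties as ℕₚ

-- The orders <₀ and <₁ on [k]

-- Reversal is its own inverse, so `ord s` turns a 0-based rank in the order `<_s` into an element
-- and an element into its rank.
ord : {κ : ℕ} → Bool → Fin κ → Fin κ
ord true  i = i
ord false i = opposite i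

ord-involutive : ∀ {κ} s (i : Fin κ) → ord s (ord s i) ≡ i
ord-involutive true  i = refl
ord-involutive false i = opposite-involutive i

num-ord : ∀ {κ} s (i : Fin κ) → num s κ (ord s i) ≡ suc (toℕ i)
num-ord true  i = refl
num-ord {κ} false i = trans (cong (κ ∸_) (opposite-prop i)) (ℕₚ.m∸[m∸n]≡n (toℕ<n i))

num<⇒Precedes : ∀ {κ} s {i j : Fin κ} → num s κ i < num s κ j → Precedes s i j
num<⇒Precedes true  p = ℕₚ.≤-pred p
num<⇒Precedes {κ} false {i} {j} p = ℕₚ.∸-cancelʳ-< {toℕ i} {toℕ j} {κ} p

num-injective : ∀ {κ} s {i j : Fin κ} → num s κ i ≡ num s κ j → i ≡ j
num-injective true  e = toℕ-injective (ℕₚ.suc-injective e)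
num-injective false {i} {j} e =
  toℕ-injective (ℕₚ.∸-cancelˡ-≡ (ℕₚ.<⇒≤ (toℕ<n i)) (ℕₚ.<⇒≤ (toℕ<n j)) e)

Precedes-irrefl : ∀ {κ} s {i : Fin κ} → ¬ Precedes s i i
Precedes-irrefl true  = ℕₚ.<-irrefl refl
Precedes-irrefl false = ℕₚ.<-irrefl refl

Precedes-asym : ∀ {κ} s {i j : Fin κ} → Precedes s i j → ¬ Precedes s j i
Precedes-asym true  = ℕₚ.<-asym
Precedes-asym false = ℕₚ.<-asym

ord-Precedes : ∀ {κ} s {i j : Fin κ} → toℕ i < toℕ j → Precedes s (ord s i) (ord s j)
ord-Precedes s {i} {j} p =
  num<⇒Precedes s (subst₂ _<_ (sym (num-ord s i)) (sym (num-ord s j)) (s≤s p))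

-- The order on K when the first index i₁ is s instead of 1

LessK : ∀ {d k} → Bool → K d k → K d k → Set
LessK {d} s α β = Σ (Fin d) λ l →
  ((m : Fin d) → m Data.Fin.< l → α m ≡ β m) × Precedes (indFrom s α l) (α l) (β l)

LeK : ∀ {d k} → Bool → K d k → K d k → Set
LeK s α β = (∀ l → α l ≡ β l) ⊎ LessK s α β

IsLargest : ∀ d k → Bool → (Var d k → Bool) → K d k → Set
IsLargest d k s a α =
  ¬ (prodDiff d k a α ≡ + 0) × (∀ β → ¬ (prodDiff d k a β ≡ + 0) → LeK s β α)

consK : ∀ {d} {k : Fin (suc d) → ℕ} → Fin (k Fin.zero) → K d (k ∘ Fin.suc) → K (suc d) k
consK j β Fin.zero    = j
consK j β (Fin.suc i) = β i

-- Integers up to sign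

-- The three-valued sign: unlike `sgn` it is odd and multiplicative, so it passes through products
-- of differences.
sg : ℤ → ℤ
sg (+ 0)     = + 0
sg (+ suc _) = + 1
sg -[1+ _ ]  = -[1+ 0 ]

sgn-sg : ∀ z → sgn (sg z) ≡ sgn z
sgn-sg (+ 0)     = refl
sgn-sg (+ suc _) = refl
sgn-sg -[1+ _ ]  = refl

sg-neg : ∀ z → sg (ℤ.- z) ≡ ℤ.- sg z
sg-neg (+ 0)     = refl
sg-neg (+ suc _) = refl
sg-neg -[1+ _ ]  = refl

sg-* : ∀ x y → sg (x ℤ.* y) ≡ sg x ℤ.* sg y
sg-* (+ 0)     y         = refl
sg-* x@(+ suc _) (+ 0)   = cong sg (ℤₚ.*-zeroʳ x)
sg-* (+ suc _) (+ suc _) = refl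
sg-* (+ suc _) -[1+ _ ]  = refl
sg-* x@(-[1+ _ ]) (+ 0)  = cong sg (ℤₚ.*-zeroʳ x)
sg-* -[1+ _ ]  (+ suc _) = refl
sg-* -[1+ _ ]  -[1+ _ ]  = refl

*-nonZero : ∀ {x y : ℤ} → ¬ (x ≡ + 0) → ¬ (y ≡ + 0) → ¬ (x ℤ.* y ≡ + 0)
*-nonZero {x} x≢0 y≢0 e with ℤₚ.i*j≡0⇒i≡0∨j≡0 x e
... | inj₁ p = x≢0 p
... | inj₂ p = y≢0 p

sg-⊖ : ∀ {m n} → n < m → sg (m ℤ.⊖ n) ≡ + 1
sg-⊖ {m} {n} p rewrite ℤₚ.⊖-≥ (ℕₚ.<⇒≤ p) with m ∸ n | ℕₚ.m<n⇒0<n∸m p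
... | suc _ | _ = refl

sg-dominated⁺ : ∀ w n y → ∣ y ∣ ≤ w → sg (+ suc w ℤ.* + suc n ℤ.+ y) ≡ + 1
sg-dominated⁺ w n (+ b)    p = refl
sg-dominated⁺ w n -[1+ b ] p = sg-⊖ {suc w * suc n} (ℕₚ.≤-trans (s≤s p) (ℕₚ.m≤m*n (suc w) (suc n)))

-- A nonzero integer times `suc w` has absolute value above `w`, so `y` cannot change its sign. The
-- negative case is the positive one negated.
sg-dominated : ∀ w x y → ∣ y ∣ ≤ w → ¬ (x ≡ + 0) → sg (+ suc w ℤ.* x ℤ.+ y) ≡ sg x
sg-dominated w (+ 0)     y p x≢0 = contradiction refl x≢0
sg-dominated w (+ suc n) y p _   = sg-dominated⁺ w n y p
sg-dominated w -[1+ n ]  y p _   = begin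
  sg (c ℤ.* -[1+ n ] ℤ.+ y)                ≡⟨ cong sg (flip c (+ suc n) y) ⟩
  sg (ℤ.- (c ℤ.* + suc n ℤ.+ ℤ.- y))       ≡⟨ sg-neg (c ℤ.* + suc n ℤ.+ ℤ.- y) ⟩
  ℤ.- sg (c ℤ.* + suc n ℤ.+ ℤ.- y)         ≡⟨ cong ℤ.-_ (sg-dominated⁺ w n (ℤ.- y) (subst (_≤ w) (sym (ℤₚ.∣-i∣≡∣i∣ y)) p)) ⟩
  -[1+ 0 ]                                 ∎
  where
  open ≡-Reasoning
  c = + suc w
  flip : ∀ c x y → c ℤ.* (ℤ.- x) ℤ.+ y ≡ ℤ.- (c ℤ.* x ℤ.+ ℤ.- y)
  flip = solve-∀

-- Polynomial arithmetic

∣evalMono∣≤1 : ∀ {V} (a : V → Bool) m → ∣ evalMono a m ∣ ≤ 1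
∣evalMono∣≤1 a []      = ℕₚ.≤-refl
∣evalMono∣≤1 a (v ∷ m) with a v
... | true  = subst (λ z → ∣ z ∣ ≤ 1) (sym (ℤₚ.*-identityˡ (evalMono a m))) (∣evalMono∣≤1 a m)
... | false = z≤n

∣eval∣≤weight : ∀ {V} (p : Poly V) a → ∣ eval p a ∣ ≤ weight p
∣eval∣≤weight []            a = z≤n
∣eval∣≤weight ((c , m) ∷ p) a =
  ℕₚ.≤-trans (ℤₚ.∣i+j∣≤∣i∣+∣j∣ (c ℤ.* evalMono a m) (eval p a))
    (ℕₚ.+-mono-≤ term (∣eval∣≤weight p a))
  where
  open ℕₚ.≤-Reasoning
  term : ∣ c ℤ.* evalMono a m ∣ ≤ ∣ c ∣
  term = begin
    ∣ c ℤ.* evalMono a m ∣     ≡⟨ ℤₚ.abs-* c (evalMono a m) ⟩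
    ∣ c ∣ * ∣ evalMono a m ∣   ≤⟨ ℕₚ.*-monoʳ-≤ ∣ c ∣ (∣evalMono∣≤1 a m) ⟩
    ∣ c ∣ * 1                  ≡⟨ ℕₚ.*-identityʳ ∣ c ∣ ⟩
    ∣ c ∣                      ∎

scaleP : ∀ {V} → ℤ → Poly V → Poly V
scaleP e = map λ { (c , m) → e ℤ.* c , m }

renameP : ∀ {V W} → (V → W) → Poly V → Poly W
renameP f = map λ { (c , m) → c , map f m }

varP : ∀ {V} → V → Poly V → Poly V
varP v = map λ { (c , m) → c , v ∷ m }

eval-++ : ∀ {V} (p q : Poly V) a → eval (p ++ q) a ≡ eval p a ℤ.+ eval q a
eval-++ []            q a = sym (ℤₚ.+-identityˡ (eval q a))
eval-++ ((c , m) ∷ p) q a =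
  trans (cong (λ z → c ℤ.* evalMono a m ℤ.+ z) (eval-++ p q a))
        (sym (ℤₚ.+-assoc (c ℤ.* evalMono a m) (eval p a) (eval q a)))

eval-scaleP : ∀ {V} e (p : Poly V) a → eval (scaleP e p) a ≡ e ℤ.* eval p a
eval-scaleP e []            a = sym (ℤₚ.*-zeroʳ e)
eval-scaleP e ((c , m) ∷ p) a =
  trans (cong (λ z → e ℤ.* c ℤ.* evalMono a m ℤ.+ z) (eval-scaleP e p a))
        (lemma e c (evalMono a m) (eval p a))
  where
  lemma : ∀ e c x y → e ℤ.* c ℤ.* x ℤ.+ e ℤ.* y ≡ e ℤ.* (c ℤ.* x ℤ.+ y)
  lemma = solve-∀

evalMono-map : ∀ {V W} (f : V → W) m a → evalMono a (map f m) ≡ evalMono (a ∘ f) m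
evalMono-map f []      a = refl
evalMono-map f (v ∷ m) a = cong (b2z (a (f v)) ℤ.*_) (evalMono-map f m a)

eval-renameP : ∀ {V W} (f : V → W) p a → eval (renameP f p) a ≡ eval p (a ∘ f)
eval-renameP f []            a = refl
eval-renameP f ((c , m) ∷ p) a =
  cong₂ (λ x y → c ℤ.* x ℤ.+ y) (evalMono-map f m a) (eval-renameP f p a)

eval-varP : ∀ {V} (v : V) p a → eval (varP v p) a ≡ b2z (a v) ℤ.* eval p a
eval-varP v []            a = sym (ℤₚ.*-zeroʳ (b2z (a v)))
eval-varP v ((c , m) ∷ p) a =
  trans (cong (λ z → c ℤ.* (b2z (a v) ℤ.* evalMono a m) ℤ.+ z) (eval-varP v p a))
        (lemma (b2z (a v)) c (evalMono a m) (eval p a))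
  where
  lemma : ∀ v c x y → c ℤ.* (v ℤ.* x) ℤ.+ v ℤ.* y ≡ v ℤ.* (c ℤ.* x ℤ.+ y)
  lemma = solve-∀

-- Unlike degree, this bounds the terms with coefficient 0 as well.
MonosBelow : ∀ {V : Set} → ℕ → Poly V → Set
MonosBelow d = All λ t → length (proj₂ t) ≤ d

MonosBelow⇒degree≤ : ∀ {V d} (p : Poly V) → MonosBelow d p → degree p ≤ d
MonosBelow⇒degree≤ []                    []       = z≤n
MonosBelow⇒degree≤ ((+ 0      , m) ∷ p) (_ ∷ bs) = MonosBelow⇒degree≤ p bs
MonosBelow⇒degree≤ ((+ suc _  , m) ∷ p) (b ∷ bs) = ℕₚ.⊔-lub b (MonosBelow⇒degree≤ p bs)
MonosBelow⇒degree≤ ((-[1+ _ ] , m) ∷ p) (b ∷ bs) = ℕₚ.⊔-lub b (MonosBelow⇒degree≤ p bs)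

-- A threshold gate of degree d

-- The weight of an accumulator bounds its values, so each new term overrules everything before it.
dominate : ∀ {V} κ → (Fin κ → Poly V) → Poly V → Poly V
dominate zero    τ acc = acc
dominate (suc κ) τ acc =
  dominate κ (τ ∘ Fin.suc) (scaleP (+ suc (weight acc)) (τ Fin.zero) ++ acc)

eval-dominate-step : ∀ {V} (τ acc : Poly V) a →
  eval (scaleP (+ suc (weight acc)) τ ++ acc) a ≡ + suc (weight acc) ℤ.* eval τ a ℤ.+ eval acc a
eval-dominate-step τ acc a =
  trans (eval-++ (scaleP (+ suc (weight acc)) τ) acc a)
        (cong (ℤ._+ eval acc a) (eval-scaleP (+ suc (weight acc)) τ a))

dominate-zero : ∀ {V} κ (τ : Fin κ → Poly V) acc a →
  (∀ i → eval (τ i) a ≡ + 0) → eval (dominate κ τ acc) a ≡ eval acc a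
dominate-zero zero    τ acc a h = refl
dominate-zero (suc κ) τ acc a h = begin
  eval (dominate κ (τ ∘ Fin.suc) acc′) a    ≡⟨ dominate-zero κ (τ ∘ Fin.suc) acc′ a (h ∘ Fin.suc) ⟩
  eval acc′ a                               ≡⟨ eval-dominate-step (τ Fin.zero) acc a ⟩
  c ℤ.* eval (τ Fin.zero) a ℤ.+ eval acc a  ≡⟨ cong (λ z → c ℤ.* z ℤ.+ eval acc a) (h Fin.zero) ⟩
  c ℤ.* + 0 ℤ.+ eval acc a                  ≡⟨ cong (ℤ._+ eval acc a) (ℤₚ.*-zeroʳ c) ⟩
  + 0 ℤ.+ eval acc a                        ≡⟨ ℤₚ.+-identityˡ (eval acc a) ⟩
  eval acc a                                ∎
  where
  open ≡-Reasoning
  c    = + suc (weight acc)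
  acc′ = scaleP c (τ Fin.zero) ++ acc

-- The terms after `j` contribute nothing at `a`, and the factor given to `τ j` exceeds the weight
-- of everything accumulated before it.
sg-dominate : ∀ {V} κ (τ : Fin κ → Poly V) acc a j →
  ¬ (eval (τ j) a ≡ + 0) → (∀ i → toℕ j < toℕ i → eval (τ i) a ≡ + 0) →
  sg (eval (dominate κ τ acc) a) ≡ sg (eval (τ j) a)
sg-dominate (suc κ) τ acc a Fin.zero nz h = begin
  sg (eval (dominate κ (τ ∘ Fin.suc) acc′) a)
    ≡⟨ cong sg (dominate-zero κ (τ ∘ Fin.suc) acc′ a (λ i → h (Fin.suc i) (s≤s z≤n))) ⟩
  sg (eval acc′ a)
    ≡⟨ cong sg (eval-dominate-step (τ Fin.zero) acc a) ⟩
  sg (+ suc (weight acc) ℤ.* eval (τ Fin.zero) a ℤ.+ eval acc a)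
    ≡⟨ sg-dominated (weight acc) (eval (τ Fin.zero) a) (eval acc a) (∣eval∣≤weight acc a) nz ⟩
  sg (eval (τ Fin.zero) a) ∎
  where
  open ≡-Reasoning
  acc′ = scaleP (+ suc (weight acc)) (τ Fin.zero) ++ acc
sg-dominate (suc κ) τ acc a (Fin.suc j) nz h =
  sg-dominate κ (τ ∘ Fin.suc) _ a j nz (λ i p → h (Fin.suc i) (s≤s p))

dominate-MonosBelow : ∀ {V d} κ (τ : Fin κ → Poly V) acc →
  (∀ i → MonosBelow d (τ i)) → MonosBelow d acc → MonosBelow d (dominate κ τ acc)
dominate-MonosBelow zero    τ acc hτ ha = ha
dominate-MonosBelow (suc κ) τ acc hτ ha =
  dominate-MonosBelow κ (τ ∘ Fin.suc) _ (hτ ∘ Fin.suc) (++⁺ (map⁺ (hτ Fin.zero)) ha)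

-- The gate by recursion on the blocks

liftVar : ∀ {d} {k : Fin (suc d) → ℕ} → Var d (k ∘ Fin.suc) → Var (suc d) k
liftVar (b , i , j) = b , Fin.suc i , j

diff₀ : ∀ {d} {k : Fin (suc d) → ℕ} → (Var (suc d) k → Bool) → Fin (k Fin.zero) → ℤ
diff₀ a j = b2z (a (true , Fin.zero , j)) ℤ.- b2z (a (false , Fin.zero , j))

mulDiff : ∀ {d} {k : Fin (suc d) → ℕ} → Fin (k Fin.zero) → Poly (Var d (k ∘ Fin.suc)) → Poly (Var (suc d) k)
mulDiff j p =
  varP (true , Fin.zero , j) (renameP liftVar p)
  ++ scaleP -[1+ 0 ] (varP (false , Fin.zero , j) (renameP liftVar p))

eval-mulDiff : ∀ {d} {k : Fin (suc d) → ℕ} j (p : Poly (Var d (k ∘ Fin.suc))) (a : Var (suc d) k → Bool) →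
  eval (mulDiff {k = k} j p) a ≡ diff₀ {k = k} a j ℤ.* eval p (a ∘ liftVar)
eval-mulDiff {k = k} j p a = begin
  eval (varP x p′ ++ scaleP -[1+ 0 ] (varP y p′)) a
    ≡⟨ eval-++ (varP x p′) _ a ⟩
  eval (varP x p′) a ℤ.+ eval (scaleP -[1+ 0 ] (varP y p′)) a
    ≡⟨ cong₂ ℤ._+_ (eval-varP x p′ a)
         (trans (eval-scaleP -[1+ 0 ] (varP y p′) a) (cong (-[1+ 0 ] ℤ.*_) (eval-varP y p′ a))) ⟩
  b2z (a x) ℤ.* eval p′ a ℤ.+ -[1+ 0 ] ℤ.* (b2z (a y) ℤ.* eval p′ a)
    ≡⟨ lemma (b2z (a x)) (b2z (a y)) (eval p′ a) ⟩
  diff₀ {k = k} a j ℤ.* eval p′ a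
    ≡⟨ cong (diff₀ {k = k} a j ℤ.*_) (eval-renameP liftVar p a) ⟩
  diff₀ {k = k} a j ℤ.* eval p (a ∘ liftVar) ∎
  where
  open ≡-Reasoning
  p′ = renameP liftVar p
  x y : Var _ k
  x  = true  , Fin.zero , j
  y  = false , Fin.zero , j
  lemma : ∀ x y z → x ℤ.* z ℤ.+ -[1+ 0 ] ℤ.* (y ℤ.* z) ≡ (x ℤ.- y) ℤ.* z
  lemma = solve-∀

-- The elements of K with first coordinate `j` form an interval, ordered inside by the index
-- `parity (num s _ j)`. So a whole gate for the remaining blocks is multiplied by the difference at
-- `j`, and these products dominate each other in the order `<_s`.
gate : ∀ d k → Bool → Poly (Var d k)
gateTerm : ∀ d k → Bool → Fin (k Fin.zero) → Poly (Var (suc d) k)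

gate zero    k s = (+ 1 , []) ∷ []
gate (suc d) k s = dominate (k Fin.zero) (gateTerm d k s ∘ ord s) []

gateTerm d k s j = mulDiff {k = k} j (gate d (k ∘ Fin.suc) (parity (num s (k Fin.zero) j)))

gate-MonosBelow : ∀ d k s → MonosBelow d (gate d k s)
gate-MonosBelow zero    k s = z≤n ∷ []
gate-MonosBelow (suc d) k s =
  dominate-MonosBelow (k Fin.zero) _ [] (λ i → term (ord s i)) []
  where
  renamed : ∀ {p} → MonosBelow d p → MonosBelow d (renameP (liftVar {d} {k}) p)
  renamed b = map⁺ (All.map (λ {t} → subst (_≤ d) (sym (length-map (liftVar {d} {k}) (proj₂ t)))) b)
  term : ∀ j → MonosBelow (suc d) (gateTerm d k s j)
  term j = ++⁺ (map⁺ (All.map s≤s b)) (map⁺ (map⁺ (All.map s≤s b)))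
    where b = renamed (gate-MonosBelow d (k ∘ Fin.suc) (parity (num s (k Fin.zero) j)))

-- Replacing the first coordinate of `α` by `j` keeps the product nonzero, so the maximality of `α`
-- compares the two.
IsLargest-head : ∀ {d k s a α} → IsLargest (suc d) k s a α → ∀ j →
  ¬ (diff₀ {k = k} a j ≡ + 0) → j ≡ α Fin.zero ⊎ Precedes s j (α Fin.zero)
IsLargest-head {d} {k} {s} {a} {α} (nz , largest) j j≢0
  with largest (consK {k = k} j (α ∘ Fin.suc))
         (*-nonZero j≢0 λ e → nz (trans (cong (diff₀ {k = k} a (α Fin.zero) ℤ.*_) e) (ℤₚ.*-zeroʳ (diff₀ {k = k} a (α Fin.zero)))))
... | inj₁ e                    = inj₁ (e Fin.zero)
... | inj₂ (Fin.zero , _ , p)   = inj₂ p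
... | inj₂ (Fin.suc l , e , _)  = inj₁ (e Fin.zero (s≤s z≤n))

IsLargest-tail : ∀ {d k s a α} → IsLargest (suc d) k s a α →
  IsLargest d (k ∘ Fin.suc) (parity (num s (k Fin.zero) (α Fin.zero))) (a ∘ liftVar) (α ∘ Fin.suc)
IsLargest-tail {d} {k} {s} {a} {α} (nz , largest) = (λ e → nz (trans (cong (δ ℤ.*_) e) (ℤₚ.*-zeroʳ δ))) , tail
  where
  δ = diff₀ {k = k} a (α Fin.zero)
  rest = prodDiff d (k ∘ Fin.suc) (a ∘ liftVar) (α ∘ Fin.suc)
  tail : ∀ β → ¬ (prodDiff d (k ∘ Fin.suc) (a ∘ liftVar) β ≡ + 0) → LeK _ β (α ∘ Fin.suc)
  tail β β≢0 with largest (consK {k = k} (α Fin.zero) β) (*-nonZero {δ} (λ e → nz (cong (ℤ._* rest) e)) β≢0)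
  ... | inj₁ e                   = inj₁ (e ∘ Fin.suc)
  ... | inj₂ (Fin.zero , _ , p)  = contradiction p (Precedes-irrefl s)
  ... | inj₂ (Fin.suc l , e , p) = inj₂ (l , (λ m m<l → e (Fin.suc m) (s≤s m<l)) , p)

-- This covers the default value of f: the gate evaluates to 0, and `sgn` of 0 is `true`. Either the
-- difference at `j` vanishes or all products over the remaining blocks do.
gate-zero : ∀ d k s a → (∀ α → prodDiff d k a α ≡ + 0) → eval (gate d k s) a ≡ + 0
gate-zero zero    k s a h = contradiction (h λ ()) λ ()
gate-zero (suc d) k s a h = dominate-zero (k Fin.zero) _ [] a (λ i → term (ord s i))
  where
  term : ∀ j → eval (gateTerm d k s j) a ≡ + 0
  term j = trans (eval-mulDiff {k = k} j g a) (factor (diff₀ {k = k} a j ℤ.≟ + 0))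
    where
    g = gate d (k ∘ Fin.suc) (parity (num s (k Fin.zero) j))
    factor : Dec (diff₀ {k = k} a j ≡ + 0) → diff₀ {k = k} a j ℤ.* eval g (a ∘ liftVar) ≡ + 0
    factor (yes e) = cong (ℤ._* eval g (a ∘ liftVar)) e
    factor (no ne) = trans (cong (diff₀ {k = k} a j ℤ.*_) (gate-zero d _ _ (a ∘ liftVar) rest)) (ℤₚ.*-zeroʳ (diff₀ {k = k} a j))
      where
      rest : ∀ β → prodDiff d (k ∘ Fin.suc) (a ∘ liftVar) β ≡ + 0
      rest β with ℤₚ.i*j≡0⇒i≡0∨j≡0 (diff₀ {k = k} a j) (h (consK {k = k} j β))
      ... | inj₁ e = contradiction e ne
      ... | inj₂ e = e

sg≡0⇒≡0 : ∀ z → sg z ≡ + 0 → z ≡ + 0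
sg≡0⇒≡0 (+ 0) _ = refl

-- By `IsLargest-head` the last nonzero difference of the first block sits at `α Fin.zero`, so that
-- term decides the sign. It is a product, and its second factor is handled by induction.
sg-gate : ∀ d k s a α → IsLargest d k s a α → sg (eval (gate d k s) a) ≡ sg (prodDiff d k a α)
sg-gate zero    k s a α _ = refl
sg-gate (suc d) k s a α L =
  trans (sg-dominate (k Fin.zero) _ [] a n nonzero later)
        (trans (cong (λ j → sg (eval (gateTerm d k s j) a)) on) leading)
  where
  n = ord s (α Fin.zero)
  on : ord s n ≡ α Fin.zero
  on = ord-involutive s (α Fin.zero)
  s′ = parity (num s (k Fin.zero) (α Fin.zero))
  δ = diff₀ {k = k} a (α Fin.zero)
  leading : sg (eval (gateTerm d k s (α Fin.zero)) a) ≡ sg (prodDiff (suc d) k a α)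
  leading = begin
    sg (eval (gateTerm d k s (α Fin.zero)) a)
      ≡⟨ cong sg (eval-mulDiff {k = k} (α Fin.zero) (gate d (k ∘ Fin.suc) s′) a) ⟩
    sg (δ ℤ.* eval (gate d (k ∘ Fin.suc) s′) (a ∘ liftVar))
      ≡⟨ sg-* δ _ ⟩
    sg δ ℤ.* sg (eval (gate d (k ∘ Fin.suc) s′) (a ∘ liftVar))
      ≡⟨ cong (sg δ ℤ.*_) (sg-gate d (k ∘ Fin.suc) s′ (a ∘ liftVar) (α ∘ Fin.suc) (IsLargest-tail {a = a} L)) ⟩
    sg δ ℤ.* sg (prodDiff d (k ∘ Fin.suc) (a ∘ liftVar) (α ∘ Fin.suc))
      ≡⟨ sg-* δ _ ⟨
    sg (prodDiff (suc d) k a α) ∎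
    where open ≡-Reasoning
  nonzero : ¬ (eval (gateTerm d k s (ord s n)) a ≡ + 0)
  nonzero e = proj₁ L (sg≡0⇒≡0 _ (trans (sym leading) (cong sg (subst (λ j → eval (gateTerm d k s j) a ≡ + 0) on e))))
  later : ∀ i → toℕ n < toℕ i → eval (gateTerm d k s (ord s i)) a ≡ + 0
  later i n<i with diff₀ {k = k} a (ord s i) ℤ.≟ + 0
  ... | yes e = trans (eval-mulDiff {k = k} (ord s i) g a) (cong (ℤ._* eval g (a ∘ liftVar)) e)
    where g = gate d (k ∘ Fin.suc) (parity (num s (k Fin.zero) (ord s i)))
  ... | no ne = ⊥-elim (absurd (IsLargest-head {k = k} {a = a} L (ord s i) ne))
    where
    prec : Precedes s (α Fin.zero) (ord s i)
    prec = subst (λ j → Precedes s j (ord s i)) on (ord-Precedes s n<i)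
    absurd : ¬ (ord s i ≡ α Fin.zero ⊎ Precedes s (ord s i) (α Fin.zero))
    absurd (inj₁ e) = Precedes-irrefl s (subst (Precedes s (α Fin.zero)) e prec)
    absurd (inj₂ p) = Precedes-asym s p prec

gate-isThresholdGate : ∀ d k → IsThresholdGate (F d k) (gate d k true)
gate-isThresholdGate d k a b (inj₁ (α , L , refl)) = begin
  sgn (eval (gate d k true) a)       ≡⟨ sgn-sg _ ⟨
  sgn (sg (eval (gate d k true) a))  ≡⟨ cong sgn (sg-gate d k true a α L) ⟩
  sgn (sg (prodDiff d k a α))        ≡⟨ sgn-sg _ ⟩
  sgn (prodDiff d k a α)             ∎
  where open ≡-Reasoning
gate-isThresholdGate d k a b (inj₂ (h , refl)) = cong sgn (gate-zero d k true a h)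

-- Alternating sums over the swaps x^i ↔ y^i

Block : ℕ → Set
Block κ = Bool × Fin κ → Bool

diff : ∀ {κ} → Block κ → Fin κ → ℤ
diff b j = b2z (b (true , j)) ℤ.- b2z (b (false , j))

swap : ∀ {κ} → Block κ → Block κ
swap b (s , j) = b (not s , j)

infixr 4 _▹_

-- Assignments given block by block, so that swaps and linearity in each block can be treated by
-- recursion on `d`.
data Blocks : ∀ d → (Fin d → ℕ) → Set where
  []  : ∀ {k} → Blocks zero k
  _▹_ : ∀ {d k} → Block (k Fin.zero) → Blocks d (k ∘ Fin.suc) → Blocks (suc d) k

flatten : ∀ {d k} → Blocks d k → Var d k → Bool
flatten {suc d} (b ▹ t) (s , Fin.zero  , j) = b (s , j)
flatten {suc d} (b ▹ t) (s , Fin.suc i , j) = flatten t (s , i , j)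

altSum : ∀ d {k} → (Blocks d k → ℤ) → Blocks d k → ℤ
altSum zero    g t       = g t
altSum (suc d) g (b ▹ t) =
  altSum d (λ t′ → g (b ▹ t′)) t ℤ.- altSum d (λ t′ → g (swap b ▹ t′)) t

altSum-cong : ∀ d {k} {g h : Blocks d k → ℤ} → (∀ t → g t ≡ h t) → ∀ t → altSum d g t ≡ altSum d h t
altSum-cong zero    e t       = e t
altSum-cong (suc d) e (b ▹ t) =
  cong₂ ℤ._-_ (altSum-cong d (λ t′ → e (b ▹ t′)) t) (altSum-cong d (λ t′ → e (swap b ▹ t′)) t)

altSum-scale : ∀ d {k} c (g : Blocks d k → ℤ) t → altSum d (λ t → c ℤ.* g t) t ≡ c ℤ.* altSum d g t
altSum-scale zero    c g t       = refl
altSum-scale (suc d) c g (b ▹ t) =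
  trans (cong₂ ℤ._-_ (altSum-scale d c (λ t′ → g (b ▹ t′)) t) (altSum-scale d c (λ t′ → g (swap b ▹ t′)) t))
        (lemma c _ _)
  where
  lemma : ∀ c x y → c ℤ.* x ℤ.- c ℤ.* y ≡ c ℤ.* (x ℤ.- y)
  lemma = solve-∀

altSum-+ : ∀ d {k} (g h : Blocks d k → ℤ) t →
  altSum d (λ t → g t ℤ.+ h t) t ≡ altSum d g t ℤ.+ altSum d h t
altSum-+ zero    g h t       = refl
altSum-+ (suc d) g h (b ▹ t) =
  trans (cong₂ ℤ._-_ (altSum-+ d (λ t′ → g (b ▹ t′)) (λ t′ → h (b ▹ t′)) t)
                     (altSum-+ d (λ t′ → g (swap b ▹ t′)) (λ t′ → h (swap b ▹ t′)) t))
        (lemma (altSum d (λ t′ → g (b ▹ t′)) t) (altSum d (λ t′ → h (b ▹ t′)) t) _ _)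
  where
  lemma : ∀ x y z w → x ℤ.+ y ℤ.- (z ℤ.+ w) ≡ x ℤ.- z ℤ.+ (y ℤ.- w)
  lemma = solve-∀

altSum-0 : ∀ d {k} (t : Blocks d k) → altSum d (λ _ → + 0) t ≡ + 0
altSum-0 zero    t       = refl
altSum-0 (suc d) (b ▹ t) = cong₂ ℤ._-_ (altSum-0 d t) (altSum-0 d t)

∣altSum∣≤ : ∀ d {k} w (g : Blocks d k → ℤ) → (∀ t → ∣ g t ∣ ≤ w) → ∀ t → ∣ altSum d g t ∣ ≤ 2 ^ d * w
∣altSum∣≤ zero    w g h t       = subst (∣ g t ∣ ≤_) (sym (ℕₚ.*-identityˡ w)) (h t)
∣altSum∣≤ (suc d) w g h (b ▹ t) = begin
  ∣ x ℤ.- y ∣              ≤⟨ ℤₚ.∣i-j∣≤∣i∣+∣j∣ x y ⟩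
  ∣ x ∣ + ∣ y ∣            ≤⟨ ℕₚ.+-mono-≤ (∣altSum∣≤ d w _ (λ t′ → h (b ▹ t′)) t) (∣altSum∣≤ d w _ (λ t′ → h (swap b ▹ t′)) t) ⟩
  2 ^ d * w + 2 ^ d * w    ≡⟨ ℕₚ.*-distribʳ-+ w (2 ^ d) (2 ^ d) ⟨
  (2 ^ d + 2 ^ d) * w      ≡⟨ cong (λ z → (2 ^ d + z) * w) (ℕₚ.+-identityʳ (2 ^ d)) ⟨
  2 ^ suc d * w            ∎
  where
  open ℕₚ.≤-Reasoning
  x = altSum d (λ t′ → g (b ▹ t′)) t
  y = altSum d (λ t′ → g (swap b ▹ t′)) t

-- Positivity at leading terms

swaps : ∀ {d k} → Vec Bool d → Blocks d k → Blocks d k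
swaps {zero}  []          t       = t
swaps {suc d} (false ∷ z) (b ▹ t) = b ▹ swaps z t
swaps {suc d} (true  ∷ z) (b ▹ t) = swap b ▹ swaps z t

flips : ∀ {d} → Vec Bool d → Bool → Bool
flips []      ε = ε
flips (b ∷ z) ε = flips z (b xor ε)

sgn-minus : ∀ x y ε → sgn x ≡ ε → sgn y ≡ not ε → sgn (x ℤ.- y) ≡ ε
sgn-minus (+ m)    -[1+ n ]  true  _ _ = refl
sgn-minus -[1+ m ] (+ 0)     false _ _ = refl
sgn-minus -[1+ m ] (+ suc n) false _ _ = refl

0<minus : ∀ x y → sgn x ≡ true → sgn y ≡ false → + 0 ℤ.< x ℤ.- y
0<minus (+ m) -[1+ n ] _ _ = ℤ.+<+ (subst (0 <_) (sym (ℕₚ.+-suc m n)) (s≤s z≤n))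

sgn-altSum : ∀ d {k} (g : Blocks d k → ℤ) t ε →
  (∀ z → sgn (g (swaps z t)) ≡ flips z ε) → sgn (altSum d g t) ≡ ε
sgn-altSum zero    g t       ε h = h []
sgn-altSum (suc d) g (b ▹ t) ε h =
  sgn-minus _ _ ε (sgn-altSum d _ t ε (λ z → h (false ∷ z))) (sgn-altSum d _ t (not ε) (λ z → h (true ∷ z)))

-- No cancellation occurs, as the terms that enter with a minus sign are those where `g` has the
-- opposite sign. Since `sgn` identifies zero with positive, strictness comes from the first swap: a
-- value at least 0 minus a value below 0. Hence at least one block is required.
0<altSum : ∀ d {k} (g : Blocks (suc d) k → ℤ) t →
  (∀ z → sgn (g (swaps z t)) ≡ flips z true) → + 0 ℤ.< altSum (suc d) g t
0<altSum d g (b ▹ t) h =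
  0<minus _ _ (sgn-altSum d _ t true (λ z → h (false ∷ z))) (sgn-altSum d _ t false (λ z → h (true ∷ z)))

±1 : Bool → ℤ
±1 true  = + 1
±1 false = -[1+ 0 ]

±1-flips-not : ∀ {d} (z : Vec Bool d) ε → ±1 (flips z (not ε)) ≡ ℤ.- ±1 (flips z ε)
±1-flips-not []          true  = refl
±1-flips-not []          false = refl
±1-flips-not (true  ∷ z) ε     = ±1-flips-not z (not ε)
±1-flips-not (false ∷ z) ε     = ±1-flips-not z ε

-- Each swapped block negates exactly one factor.
prodDiff-swaps : ∀ d k (z : Vec Bool d) (t : Blocks d k) α →
  prodDiff d k (flatten (swaps z t)) α ≡ ±1 (flips z true) ℤ.* prodDiff d k (flatten t) α
prodDiff-swaps zero    k []          t       α = refl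
prodDiff-swaps (suc d) k (false ∷ z) (b ▹ t) α =
  trans (cong (diff b (α Fin.zero) ℤ.*_) (prodDiff-swaps d (k ∘ Fin.suc) z t (α ∘ Fin.suc)))
        (lemma (diff b (α Fin.zero)) (±1 (flips z true)) _)
  where
  lemma : ∀ x y w → x ℤ.* (y ℤ.* w) ≡ y ℤ.* (x ℤ.* w)
  lemma = solve-∀
prodDiff-swaps (suc d) k (true ∷ z) (b ▹ t) α = begin
  diff (swap b) j ℤ.* prodDiff d (k ∘ Fin.suc) (flatten (swaps z t)) (α ∘ Fin.suc)
    ≡⟨ cong (diff (swap b) j ℤ.*_) (prodDiff-swaps d (k ∘ Fin.suc) z t (α ∘ Fin.suc)) ⟩
  diff (swap b) j ℤ.* (±1 (flips z true) ℤ.* P)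
    ≡⟨ lemma (b2z (b (true , j))) (b2z (b (false , j))) (±1 (flips z true)) P ⟩
  (ℤ.- ±1 (flips z true)) ℤ.* (diff b j ℤ.* P)
    ≡⟨ cong (ℤ._* (diff b j ℤ.* P)) (±1-flips-not z true) ⟨
  ±1 (flips z false) ℤ.* (diff b j ℤ.* P) ∎
  where
  open ≡-Reasoning
  j = α Fin.zero
  P = prodDiff d (k ∘ Fin.suc) (flatten t) (α ∘ Fin.suc)
  lemma : ∀ x y e w → (y ℤ.- x) ℤ.* (e ℤ.* w) ≡ (ℤ.- e) ℤ.* ((x ℤ.- y) ℤ.* w)
  lemma = solve-∀

LeadsBlock : ∀ {κ} → Bool → Block κ → Fin κ → Set
LeadsBlock s b j = diff b j ≡ + 1 × (∀ i → ¬ (diff b i ≡ + 0) → i ≡ j ⊎ Precedes s i j)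

-- A condition checkable one block at a time which ensures that `α` is the largest element with
-- nonzero product, and that this product is +1.
Leads : ∀ d k → Bool → Blocks d k → K d k → Set
Leads zero    k s t       α = ⊤
Leads (suc d) k s (b ▹ t) α =
  LeadsBlock s b (α Fin.zero)
  × Leads d (k ∘ Fin.suc) (parity (num s (k Fin.zero) (α Fin.zero))) t (α ∘ Fin.suc)

Leads⇒prodDiff≡1 : ∀ d k s t α → Leads d k s t α → prodDiff d k (flatten t) α ≡ + 1
Leads⇒prodDiff≡1 zero    k s t       α _               = refl
Leads⇒prodDiff≡1 (suc d) k s (b ▹ t) α ((e , _) , lead) =
  cong₂ ℤ._*_ e (Leads⇒prodDiff≡1 d (k ∘ Fin.suc) _ t (α ∘ Fin.suc) lead)

Leads⇒LeK : ∀ d k s t α → Leads d k s t α →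
  ∀ β → ¬ (prodDiff d k (flatten t) β ≡ + 0) → LeK s β α
Leads⇒LeK zero    k s t       α _                      β nz = inj₁ λ ()
Leads⇒LeK (suc d) k s (b ▹ t) α ((_ , first) , lead) β nz
  with first (β Fin.zero) (λ e → nz (cong (ℤ._* rest) e))
  where rest = prodDiff d (k ∘ Fin.suc) (flatten t) (β ∘ Fin.suc)
... | inj₂ p  = inj₂ (Fin.zero , (λ _ ()) , p)
... | inj₁ e₀ with Leads⇒LeK d (k ∘ Fin.suc) _ t (α ∘ Fin.suc) lead (β ∘ Fin.suc)
                    (λ e → nz (trans (cong (diff b (β Fin.zero) ℤ.*_) e) (ℤₚ.*-zeroʳ (diff b (β Fin.zero)))))
... | inj₁ e             = inj₁ λ { Fin.zero → e₀ ; (Fin.suc l) → e l }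
... | inj₂ (l , e , p)   = inj₂ (Fin.suc l , (λ { Fin.zero _ → e₀ ; (Fin.suc m) (s≤s q) → e m q })
    -- The later indices are computed from the first coordinate of `β`, whereas the recursive call
    -- uses that of `α`.
    , subst (λ i → Precedes (indFrom (parity (num s (k Fin.zero) i)) (β ∘ Fin.suc) l) (β (Fin.suc l)) (α (Fin.suc l)))
            (sym e₀) p)

gateSum : ∀ {d k} → Poly (Var d k) → Blocks d k → ℤ
gateSum {d} p = altSum d (λ t → eval p (flatten t))

±1-nonZero : ∀ ε {x} → ¬ (x ≡ + 0) → ¬ (±1 ε ℤ.* x ≡ + 0)
±1-nonZero true  = *-nonZero {+ 1} λ ()
±1-nonZero false = *-nonZero { -[1+ 0 ]} λ ()

sgn-±1 : ∀ ε → sgn (±1 ε ℤ.* + 1) ≡ ε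
sgn-±1 true  = refl
sgn-±1 false = refl

-- Swaps change products only in sign, so `α` stays the largest element with nonzero product, and f
-- alternates exactly as the signs of the sum do.
0<gateSum : ∀ d k (p : Poly (Var (suc d) k)) → IsThresholdGate (F (suc d) k) p →
  ∀ t α → Leads (suc d) k true t α → + 0 ℤ.< gateSum p t
0<gateSum d k p isGate t α lead = 0<altSum d _ t λ z →
  isGate (flatten (swaps z t)) (flips z true) (inj₁ (α , (nz z , largest z) , sign z))
  where
  prod : ∀ z → prodDiff (suc d) k (flatten (swaps z t)) α ≡ ±1 (flips z true) ℤ.* + 1
  prod z = trans (prodDiff-swaps (suc d) k z t α)
    (cong (±1 (flips z true) ℤ.*_) (Leads⇒prodDiff≡1 (suc d) k true t α lead))
  nz : ∀ z → ¬ (prodDiff (suc d) k (flatten (swaps z t)) α ≡ + 0)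
  nz z e = ±1-nonZero (flips z true) (λ ()) (trans (sym (prod z)) e)
  largest : ∀ z β → ¬ (prodDiff (suc d) k (flatten (swaps z t)) β ≡ + 0) → LeK true β α
  largest z β ne = Leads⇒LeK (suc d) k true t α lead β λ e → ne (trans (prodDiff-swaps (suc d) k z t β)
    (trans (cong (±1 (flips z true) ℤ.*_) e) (ℤₚ.*-zeroʳ (±1 (flips z true)))))
  sign : ∀ z → flips z true ≡ sgn (prodDiff (suc d) k (flatten (swaps z t)) α)
  sign z = sym (trans (cong sgn (prod z)) (sgn-±1 (flips z true)))

-- Multilinearity in the differences x − y

-- Blocks hold only the values 0 and 1 and cannot be added freely, so linearity in the differences
-- is stated for triples of blocks whose differences satisfy the relation.
Additive : ∀ {κ} → (Block κ → ℤ) → Set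
Additive q = ∀ b b₁ b₂ → (∀ j → diff b j ≡ diff b₁ j ℤ.- diff b₂ j) → q b ≡ q b₁ ℤ.- q b₂

Multilinear : ∀ d {k} → (Blocks d k → ℤ) → Set
Multilinear zero    Q = ⊤
Multilinear (suc d) Q = (∀ t → Additive (λ b → Q (b ▹ t))) × (∀ b → Multilinear d (λ t → Q (b ▹ t)))

Multilinear-cong : ∀ d {k} (Q R : Blocks d k → ℤ) → (∀ t → Q t ≡ R t) → Multilinear d Q → Multilinear d R
Multilinear-cong zero    Q R e _         = tt
Multilinear-cong (suc d) Q R e (add , l) =
  (λ t b b₁ b₂ h → trans (sym (e (b ▹ t))) (trans (add t b b₁ b₂ h) (cong₂ ℤ._-_ (e (b₁ ▹ t)) (e (b₂ ▹ t)))))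
  , λ b → Multilinear-cong d _ _ (λ t → e (b ▹ t)) (l b)

Multilinear-0 : ∀ d {k} → Multilinear d {k} (λ _ → + 0)
Multilinear-0 zero    = tt
Multilinear-0 (suc d) = (λ _ _ _ _ _ → refl) , λ _ → Multilinear-0 d

Multilinear-scale : ∀ d {k} c {Q : Blocks d k → ℤ} → Multilinear d Q → Multilinear d (λ t → c ℤ.* Q t)
Multilinear-scale zero    c _         = tt
Multilinear-scale (suc d) c (add , l) =
  (λ t b b₁ b₂ h → trans (cong (c ℤ.*_) (add t b b₁ b₂ h)) (lemma c _ _))
  , λ b → Multilinear-scale d c (l b)
  where
  lemma : ∀ c x y → c ℤ.* (x ℤ.- y) ≡ c ℤ.* x ℤ.- c ℤ.* y
  lemma = solve-∀

Multilinear-+ : ∀ d {k} {Q R : Blocks d k → ℤ} →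
  Multilinear d Q → Multilinear d R → Multilinear d (λ t → Q t ℤ.+ R t)
Multilinear-+ zero    _           _           = tt
Multilinear-+ (suc d) {Q = Q} {R} (add₁ , l₁) (add₂ , l₂) =
  (λ t b b₁ b₂ h → trans (cong₂ ℤ._+_ (add₁ t b b₁ b₂ h) (add₂ t b b₁ b₂ h))
                         (lemma (Q (b₁ ▹ t)) (Q (b₂ ▹ t)) (R (b₁ ▹ t)) (R (b₂ ▹ t))))
  , λ b → Multilinear-+ d (l₁ b) (l₂ b)
  where
  lemma : ∀ x y z w → x ℤ.- y ℤ.+ (z ℤ.- w) ≡ x ℤ.+ z ℤ.- (y ℤ.+ w)
  lemma = solve-∀

-- Splitting off the first block of a monomial

headVars : ∀ {d k} → Monomial (Var (suc d) k) → Monomial (Bool × Fin (k Fin.zero))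
headVars []                         = []
headVars ((s , Fin.zero  , j) ∷ m) = (s , j) ∷ headVars m
headVars ((s , Fin.suc i , j) ∷ m) = headVars m

tailVars : ∀ {d k} → Monomial (Var (suc d) k) → Monomial (Var d (k ∘ Fin.suc))
tailVars []                         = []
tailVars ((s , Fin.zero  , j) ∷ m) = tailVars m
tailVars ((s , Fin.suc i , j) ∷ m) = (s , i , j) ∷ tailVars m

length-headVars-tailVars : ∀ {d k} (m : Monomial (Var (suc d) k)) →
  length (headVars {k = k} m) + length (tailVars {k = k} m) ≡ length m
length-headVars-tailVars []                         = refl
length-headVars-tailVars {k = k} ((s , Fin.zero  , j) ∷ m) = cong suc (length-headVars-tailVars {k = k} m)
length-headVars-tailVars {k = k} ((s , Fin.suc i , j) ∷ m) =
  trans (ℕₚ.+-suc (length (headVars {k = k} m)) (length (tailVars {k = k} m)))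
        (cong suc (length-headVars-tailVars {k = k} m))

evalMono-split : ∀ {d k} b (t : Blocks d (k ∘ Fin.suc)) (m : Monomial (Var (suc d) k)) →
  evalMono (flatten {k = k} (b ▹ t)) m ≡ evalMono b (headVars {k = k} m) ℤ.* evalMono (flatten t) (tailVars {k = k} m)
evalMono-split b t []                         = refl
evalMono-split {k = k} b t ((s , Fin.zero , j) ∷ m) =
  trans (cong (b2z (b (s , j)) ℤ.*_) (evalMono-split {k = k} b t m)) (sym (ℤₚ.*-assoc (b2z (b (s , j))) _ _))
evalMono-split {k = k} b t ((s , Fin.suc i , j) ∷ m) =
  trans (cong (b2z (flatten t (s , i , j)) ℤ.*_) (evalMono-split {k = k} b t m))
        (lemma (b2z (flatten t (s , i , j))) (evalMono b (headVars {k = k} m)) _)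
  where
  lemma : ∀ x y z → x ℤ.* (y ℤ.* z) ≡ y ℤ.* (x ℤ.* z)
  lemma = solve-∀

monoSum : ∀ d {k} → Monomial (Var d k) → Blocks d k → ℤ
monoSum d m = altSum d (λ t → evalMono (flatten t) m)

swapDiff : ∀ {κ} → Monomial (Bool × Fin κ) → Block κ → ℤ
swapDiff m b = evalMono b m ℤ.- evalMono (swap b) m

splitSum : ∀ {d k} → Monomial (Bool × Fin (k Fin.zero)) → Monomial (Var d (k ∘ Fin.suc)) → Blocks (suc d) k → ℤ
splitSum {d} m₀ m′ (b ▹ t) = swapDiff m₀ b ℤ.* monoSum d m′ t

-- A monomial is a product of its parts in the first block and in the others, and the alternating
-- sum factors accordingly.
monoSum-split : ∀ d {k} (m : Monomial (Var (suc d) k)) b t →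
  monoSum (suc d) m (b ▹ t) ≡ swapDiff (headVars {k = k} m) b ℤ.* monoSum d (tailVars {k = k} m) t
monoSum-split d {k} m b t =
  trans (cong₂ ℤ._-_ (part b) (part (swap b)))
        (lemma (evalMono b m₀) (evalMono (swap b) m₀) (monoSum d (tailVars {k = k} m) t))
  where
  m₀ = headVars {k = k} m
  part : ∀ b → altSum d (λ t → evalMono (flatten {k = k} (b ▹ t)) m) t ≡ evalMono b m₀ ℤ.* monoSum d (tailVars {k = k} m) t
  part b = trans (altSum-cong d (λ t → evalMono-split {k = k} b t m) t) (altSum-scale d (evalMono b m₀) _ t)
  lemma : ∀ x y z → x ℤ.* z ℤ.- y ℤ.* z ≡ (x ℤ.- y) ℤ.* z
  lemma = solve-∀

-- Fewer than `d` variables miss some block, and swapping that block changes nothing: its factor is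
-- 1 - 1. If the first block is not missed, fewer than `d − 1` variables are left for the others.
monoSum-vanishes : ∀ d {k} (m : Monomial (Var d k)) → length m < d → ∀ t → monoSum d m t ≡ + 0
monoSum-vanishes (suc d) {k} m lt (b ▹ t) =
  trans (monoSum-split d m b t) (factor (headVars {k = k} m) (length-headVars-tailVars {k = k} m))
  where
  m′ = tailVars {k = k} m
  factor : ∀ m₀ → length m₀ + length m′ ≡ length m → swapDiff m₀ b ℤ.* monoSum d m′ t ≡ + 0
  factor []       e = refl
  factor (v ∷ m₀) e =
    trans (cong (swapDiff (v ∷ m₀) b ℤ.*_) (monoSum-vanishes d m′ shorter t)) (ℤₚ.*-zeroʳ (swapDiff (v ∷ m₀) b))
    where
    shorter : length m′ < d
    shorter = ℕₚ.≤-trans (s≤s (ℕₚ.m≤n+m (length m′) (length m₀))) (ℕₚ.≤-trans (ℕₚ.≤-reflexive e) (ℕₚ.≤-pred lt))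

-- For a single variable the swap difference is the difference x - y at its position, up to sign.
swapDiff-additive : ∀ {κ} (v : Bool × Fin κ) → Additive (swapDiff (v ∷ []))
swapDiff-additive (true , j) b b₁ b₂ h =
  trans (unfold b) (trans (h j) (sym (cong₂ ℤ._-_ (unfold b₁) (unfold b₂))))
  where
  unfold : ∀ b → swapDiff ((true , j) ∷ []) b ≡ diff b j
  unfold b = cong₂ ℤ._-_ (ℤₚ.*-identityʳ (b2z (b (true , j)))) (ℤₚ.*-identityʳ (b2z (b (false , j))))
swapDiff-additive (false , j) b b₁ b₂ h =
  trans (unfold b) (trans (cong ℤ.-_ (h j)) (trans (neg-minus (diff b₁ j) (diff b₂ j)) (sym (cong₂ ℤ._-_ (unfold b₁) (unfold b₂)))))
  where
  lemma : ∀ x y → y ℤ.* + 1 ℤ.- x ℤ.* + 1 ≡ ℤ.- (x ℤ.- y)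
  lemma = solve-∀
  unfold : ∀ b → swapDiff ((false , j) ∷ []) b ≡ ℤ.- diff b j
  unfold b = lemma (b2z (b (true , j))) (b2z (b (false , j)))
  neg-minus : ∀ x y → ℤ.- (x ℤ.- y) ≡ (ℤ.- x) ℤ.- (ℤ.- y)
  neg-minus = solve-∀

-- A monomial of degree ≤ d either uses each block exactly once or misses a block, and then it cancels.
monoSum-multilinear : ∀ d {k} (m : Monomial (Var d k)) → length m ≤ d → Multilinear d (monoSum d m)
monoSum-multilinear zero    m le = tt
monoSum-multilinear (suc d) {k} m le =
  Multilinear-cong (suc d) {k} (splitSum {k = k} (headVars {k = k} m) m′) (monoSum (suc d) m)
    (λ { (b ▹ t) → sym (monoSum-split d m b t) })
    (factor (headVars {k = k} m) (length-headVars-tailVars {k = k} m))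
  where
  m′ = tailVars {k = k} m
  factor : ∀ m₀ → length m₀ + length m′ ≡ length m →
    Multilinear (suc d) {k} (splitSum {k = k} m₀ m′)
  factor [] e = (λ _ _ _ _ _ → refl) , λ _ → Multilinear-0 d
  factor (v ∷ []) e =
    (λ t b b₁ b₂ h → trans (cong (ℤ._* monoSum d m′ t) (swapDiff-additive v b b₁ b₂ h)) (lemma (swapDiff (v ∷ []) b₁) (swapDiff (v ∷ []) b₂) (monoSum d m′ t)))
    , λ b → Multilinear-scale d (swapDiff (v ∷ []) b) (monoSum-multilinear d m′ (ℕₚ.≤-pred (subst (_≤ suc d) (sym e) le)))
    where
    lemma : ∀ x y z → (x ℤ.- y) ℤ.* z ≡ x ℤ.* z ℤ.- y ℤ.* z
    lemma = solve-∀
  factor m₀@(_ ∷ _ ∷ m₁) e =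
    Multilinear-cong (suc d) {k} (λ _ → + 0) (splitSum {k = k} m₀ m′)
      (λ { (b ▹ t) → sym (trans (cong (swapDiff m₀ b ℤ.*_) (monoSum-vanishes d m′ shorter t)) (ℤₚ.*-zeroʳ (swapDiff m₀ b))) })
      (Multilinear-0 (suc d) {k})
    where
    shorter : length m′ < d
    shorter = ℕₚ.≤-trans (s≤s (ℕₚ.m≤n+m (length m′) (length m₁)))
      (ℕₚ.≤-pred (ℕₚ.≤-trans (ℕₚ.≤-reflexive e) le))

-- `degree` skips terms with coefficient 0, so a long monomial is possible but then contributes
-- nothing.
degree-uncons : ∀ {V e} c (m : Monomial V) p → degree ((c , m) ∷ p) ≤ e →
  (c ≡ + 0 ⊎ length m ≤ e) × degree p ≤ e
degree-uncons (+ 0)     m p le = inj₁ refl , le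
degree-uncons (+ suc _) m p le = inj₂ (ℕₚ.m⊔n≤o⇒m≤o (length m) _ le) , ℕₚ.m⊔n≤o⇒n≤o (length m) _ le
degree-uncons -[1+ _ ]  m p le = inj₂ (ℕₚ.m⊔n≤o⇒m≤o (length m) _ le) , ℕₚ.m⊔n≤o⇒n≤o (length m) _ le

gateSum-uncons : ∀ d {k} c m (p : Poly (Var d k)) t →
  gateSum ((c , m) ∷ p) t ≡ c ℤ.* monoSum d m t ℤ.+ gateSum p t
gateSum-uncons d c m p t =
  trans (altSum-+ d _ _ t) (cong (ℤ._+ gateSum p t) (altSum-scale d c _ t))

gateSum-vanishes : ∀ d {k} (p : Poly (Var (suc d) k)) → degree p ≤ d → ∀ t → gateSum p t ≡ + 0
gateSum-vanishes d []            le t = altSum-0 (suc d) t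
gateSum-vanishes d ((c , m) ∷ p) le t with degree-uncons c m p le
... | c≡0⊎m≤d , le′ =
  trans (gateSum-uncons (suc d) c m p t) (cong₂ ℤ._+_ (term c≡0⊎m≤d) (gateSum-vanishes d p le′ t))
  where
  term : c ≡ + 0 ⊎ length m ≤ d → c ℤ.* monoSum (suc d) m t ≡ + 0
  term (inj₁ e) = cong (ℤ._* monoSum (suc d) m t) e
  term (inj₂ l) = trans (cong (c ℤ.*_) (monoSum-vanishes (suc d) m (s≤s l) t)) (ℤₚ.*-zeroʳ c)

gateSum-multilinear : ∀ d {k} (p : Poly (Var d k)) → degree p ≤ d → Multilinear d (gateSum p)
gateSum-multilinear d []            le = Multilinear-cong d _ _ (λ t → sym (altSum-0 d t)) (Multilinear-0 d)
gateSum-multilinear d ((c , m) ∷ p) le with degree-uncons c m p le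
... | c≡0⊎m≤d , le′ =
  Multilinear-cong d _ _ (λ t → sym (gateSum-uncons d c m p t))
    (Multilinear-+ d (term c≡0⊎m≤d) (gateSum-multilinear d p le′))
  where
  term : c ≡ + 0 ⊎ length m ≤ d → Multilinear d (λ t → c ℤ.* monoSum d m t)
  term (inj₁ refl) = Multilinear-0 d
  term (inj₂ l)    = Multilinear-scale d c (monoSum-multilinear d m l)

-- Growth along the order

block : ∀ {κ} → (Fin κ → Bool) → (Fin κ → Bool) → Block κ
block A B (true  , j) = A j
block A B (false , j) = B j

none : ∀ {κ} → Fin κ → Bool
none _ = false

is : ∀ {κ} → Fin κ → Fin κ → Bool
is j i = does (i Finₚ.≟ j)

unit : ∀ {κ} → Fin κ → Block κ
unit j = block (is j) none

indicator : ∀ {κ} → (Fin κ → Bool) → Block κ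
indicator A = block A none

block-leads : ∀ {κ} s (j : Fin κ) B → (∀ i → B i ≡ true → Precedes s i j) → LeadsBlock s (block (is j) B) j
block-leads s j B below = one , first
  where
  one : b2z (is j j) ℤ.- b2z (B j) ≡ + 1
  one with j Finₚ.≟ j | B j in eq
  ... | yes _ | false = refl
  ... | yes _ | true  = contradiction (below j eq) (Precedes-irrefl s)
  ... | no ne | _     = contradiction refl ne
  first : ∀ i → ¬ (b2z (is j i) ℤ.- b2z (B i) ≡ + 0) → i ≡ j ⊎ Precedes s i j
  first i nz with i Finₚ.≟ j | B i in eq
  ... | yes e | _     = inj₁ e
  ... | no _  | true  = inj₂ (below i eq)
  ... | no _  | false = contradiction refl nz

diff-block : ∀ {κ} (A B : Fin κ → Bool) j →
  diff (block A B) j ≡ diff (indicator A) j ℤ.- diff (indicator B) j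
diff-block A B j with A j | B j
... | true  | true  = refl
... | true  | false = refl
... | false | true  = refl
... | false | false = refl

-- The block has x equal to the unit vector at `j` and y equal to the indicator of a set of elements
-- before `j`, so its leading difference is the +1 at `j`.
Favours : ∀ {κ} → Bool → Fin κ → (Block κ → ℤ) → Set
Favours s j q = ∀ B → (∀ i → B i ≡ true → Precedes s i j) → + 0 ℤ.< q (block (is j) B)

0<minus⇒< : ∀ x y → + 0 ℤ.< x ℤ.- y → y ℤ.< x
0<minus⇒< x y p = subst₂ ℤ._<_ (ℤₚ.+-identityˡ y) (lemma x y) (ℤₚ.+-monoˡ-< y p)
  where
  lemma : ∀ x y → x ℤ.- y ℤ.+ y ≡ x
  lemma = solve-∀

-- By additivity the two sides differ by the value of `q` at `block (is j) B`.
favoured-exceeds : ∀ {κ s j} {q : Block κ → ℤ} → Additive q → Favours s j q →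
  ∀ B → (∀ i → B i ≡ true → Precedes s i j) → q (indicator B) ℤ.< q (unit j)
favoured-exceeds {j = j} {q} add fav B below =
  0<minus⇒< _ _ (subst (+ 0 ℤ.<_) (add (block (is j) B) (unit j) (indicator B) (diff-block (is j) B)) (fav B below))

-- The bound on `n` is irrelevant, so that values of `f` do not depend on the proof supplied.
geometric : ∀ {κ} c (f : ∀ n → .(n < κ) → ℤ) →
  (∀ n (p : n < κ) (q : suc n < κ) → + c ℤ.* f n p ℤ.≤ f (suc n) q) →
  ∀ n (p : n < κ) (z : 0 < κ) → + (c ^ n) ℤ.* f 0 z ℤ.≤ f n p
geometric c f step zero    p z = ℤₚ.≤-reflexive (ℤₚ.*-identityˡ (f 0 z))
geometric c f step (suc n) p z = begin
  + (c * c ^ n) ℤ.* f 0 z        ≡⟨ cong (ℤ._* f 0 z) (ℤₚ.pos-* c (c ^ n)) ⟩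
  + c ℤ.* + (c ^ n) ℤ.* f 0 z    ≡⟨ ℤₚ.*-assoc (+ c) (+ (c ^ n)) (f 0 z) ⟩
  + c ℤ.* (+ (c ^ n) ℤ.* f 0 z)  ≤⟨ ℤₚ.*-monoˡ-≤-nonNeg (+ c) (geometric c f step n n<κ z) ⟩
  + c ℤ.* f n n<κ                ≤⟨ step n n<κ p ⟩
  f (suc n) p                    ∎
  where
  open ℤₚ.≤-Reasoning
  n<κ = ℕₚ.<⇒≤ p

elt : ∀ {κ} → Bool → ∀ n → .(n < κ) → Fin κ
elt s n p = ord s (fromℕ< p)

num-elt : ∀ {κ} s n (p : n < κ) → num s κ (elt s n p) ≡ suc n
num-elt s n p = trans (num-ord s (fromℕ< p)) (cong suc (toℕ-fromℕ< p))

-- The turning point of the boustrophedon: the last element in one direction is the first in the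
-- other.
elt-last : ∀ {κ} s n (p : n < κ) (z : 0 < κ) → suc n ≡ κ → elt s n p ≡ elt (not s) 0 z
elt-last {κ} s n p z e = num-injective s (trans (num-elt s n p) (trans e (sym (last s))))
  where
  last : ∀ s → num s κ (elt (not s) 0 z) ≡ κ
  last true  = trans (cong suc (trans (opposite-prop (fromℕ< z)) (cong (λ i → κ ∸ suc i) (toℕ-fromℕ< z)))) (ℕₚ.m+[n∸m]≡n z)
  last false = cong (κ ∸_) (toℕ-fromℕ< z)

before-elt : ∀ {κ} s n (p : n < κ) i → num s κ i ≤ n → Precedes s i (elt s n p)
before-elt s n p i le = num<⇒Precedes s (subst (num s _ i <_) (sym (num-elt s n p)) (s≤s le))

initial : ∀ {κ} → Bool → ℕ → Fin κ → Bool
initial {κ} s n i = num s κ i ≤ᵇ n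

0<num : ∀ {κ} s (i : Fin κ) → 0 < num s κ i
0<num true  i = s≤s z≤n
0<num false i = ℕₚ.m<n⇒0<n∸m (toℕ<n i)

-- Telescoping: a unit vector is the difference of two consecutive initial segments, so the value of
-- an additive form there is an increment of its prefix sums.
diff-unit : ∀ {κ} s n (p : n < κ) i →
  diff (unit (elt s n p)) i ≡ diff (indicator (initial s (suc n))) i ℤ.- diff (indicator (initial s n)) i
diff-unit {κ} s n p i
  with i Finₚ.≟ elt s n p | num s κ i ≤ᵇ suc n | ℕₚ.≤ᵇ-reflects-≤ (num s κ i) (suc n)
     | num s κ i ≤ᵇ n | ℕₚ.≤ᵇ-reflects-≤ (num s κ i) n
... | yes e | true  | ofʸ _  | false | ofⁿ _  = refl
... | yes e | true  | ofʸ _  | true  | ofʸ l  =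
  contradiction (subst (_≤ n) (trans (cong (num s κ) e) (num-elt s n p)) l) (ℕₚ.<-irrefl refl)
... | yes e | false | ofⁿ ¬l | _     | _      =
  contradiction (ℕₚ.≤-reflexive (trans (cong (num s κ) e) (num-elt s n p))) ¬l
... | no _  | true  | ofʸ _  | true  | ofʸ _  = refl
... | no _  | false | ofⁿ _  | false | ofⁿ _  = refl
... | no _  | false | ofⁿ ¬l | true  | ofʸ l  = contradiction (ℕₚ.m≤n⇒m≤1+n l) ¬l
... | no ne | true  | ofʸ l  | false | ofⁿ ¬l = contradiction
  (num-injective s (trans (ℕₚ.≤-antisym l (ℕₚ.≰⇒> ¬l)) (sym (num-elt s n p)))) ne

-- Let `S n` be the value at the first `n` elements. The next unit value exceeds `S n` and equals
-- `S (suc n) − S n`, so `S` doubles at each of the `κ − 2` steps from `S 1` to `S (κ − 1)`; the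
-- last unit value exceeds `S (κ − 1)`.
last-block-growth : ∀ κ s (z : 0 < κ) → 2 ≤ κ → (q : Block κ → ℤ) → Additive q → (∀ j → Favours s j q) →
  + (2 ^ (κ ∸ 2)) ℤ.* q (unit (elt s 0 z)) ℤ.≤ q (unit (elt (not s) 0 z))
last-block-growth (suc zero) s z (s≤s ()) q add fav
last-block-growth κ@(suc (suc e)) s z le q add fav = begin
  + (2 ^ e) ℤ.* q (unit (elt s 0 z))       ≡⟨ cong (+ (2 ^ e) ℤ.*_) S₁ ⟨
  -- The sequence is shifted by one because `S 0` is 0; it starts at `S 1`, the first unit value.
  + (2 ^ e) ℤ.* S 1                        ≤⟨ geometric 2 (λ n _ → S (suc n)) double e e<κ z ⟩
  S (suc e)                                <⟨ exceeds (suc e) ℕₚ.≤-refl ⟩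
  q (unit (elt s (suc e) ℕₚ.≤-refl))       ≡⟨ cong (q ∘ unit) (elt-last s (suc e) ℕₚ.≤-refl z refl) ⟩
  q (unit (elt (not s) 0 z))               ∎
  where
  open ℤₚ.≤-Reasoning
  e<κ : e < κ
  e<κ = ℕₚ.m≤n⇒m≤1+n ℕₚ.≤-refl
  S : ℕ → ℤ
  S n = q (indicator (initial s n))
  increment : ∀ n (p : n < κ) → q (unit (elt s n p)) ≡ S (suc n) ℤ.- S n
  increment n p = add (unit (elt s n p)) _ _ (diff-unit s n p)
  exceeds : ∀ n (p : n < κ) → S n ℤ.< q (unit (elt s n p))
  exceeds n p = favoured-exceeds add (fav (elt s n p)) (initial s n) below
    where
    below : ∀ i → initial s n i ≡ true → Precedes s i (elt s n p)
    below i eq with num s κ i ≤ᵇ n | ℕₚ.≤ᵇ-reflects-≤ (num s κ i) n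
    ... | true | ofʸ l = before-elt s n p i l
  double : ∀ n (p : n < κ) (r : suc n < κ) → + 2 ℤ.* S (suc n) ℤ.≤ S (suc (suc n))
  double n _ r = begin
    + 2 ℤ.* S (suc n)                                  ≡⟨ twice (S (suc n)) ⟩
    S (suc n) ℤ.+ S (suc n)                            ≤⟨ ℤₚ.+-monoˡ-≤ (S (suc n)) (ℤₚ.<⇒≤ (exceeds (suc n) r)) ⟩
    q (unit (elt s (suc n) r)) ℤ.+ S (suc n)           ≡⟨ cong (ℤ._+ S (suc n)) (increment (suc n) r) ⟩
    S (suc (suc n)) ℤ.- S (suc n) ℤ.+ S (suc n)        ≡⟨ cancel (S (suc (suc n))) (S (suc n)) ⟩
    S (suc (suc n))                                    ∎
    where
    twice : ∀ x → + 2 ℤ.* x ≡ x ℤ.+ x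
    twice = solve-∀
    cancel : ∀ x y → x ℤ.- y ℤ.+ y ≡ x
    cancel = solve-∀
  S₀ : S 0 ≡ + 0
  -- The empty segment has zero differences, so additivity applies to three copies of it.
  S₀ = trans (add _ _ _ empty) (ℤₚ.+-inverseʳ (S 0))
    where
    empty : ∀ j → diff (indicator (initial s 0)) j ≡ diff (indicator (initial s 0)) j ℤ.- diff (indicator (initial s 0)) j
    empty j with num s κ j ≤ᵇ 0 | ℕₚ.≤ᵇ-reflects-≤ (num s κ j) 0
    ... | true  | ofʸ l = contradiction (0<num s j) (ℕₚ.≤⇒≯ l)
    ... | false | _     = refl
  S₁ : S 1 ≡ q (unit (elt s 0 z))
  S₁ = sym (trans (increment 0 z) (trans (cong (λ x → S 1 ℤ.- x) S₀) (ℤₚ.+-identityʳ (S 1))))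

-- Growth over all blocks

parity-suc : ∀ n → parity (suc n) ≡ not (parity n)
parity-suc 0             = refl
parity-suc 1             = refl
parity-suc (suc (suc n)) = parity-suc n

parity-even : ∀ {n} → 2 ∣ n → parity n ≡ false
parity-even (divides q refl) = go q
  where
  go : ∀ q → parity (q * 2) ≡ false
  go zero    = refl
  go (suc q) = go q

-- In the application q σ b is the form at b followed by the start of the σ-traversal of the remaining blocks.
inner-block-growth : ∀ κ s (z : 0 < κ) → 2 ∣ κ → ∀ c (q : Bool → Block κ → ℤ) → (∀ σ → Additive (q σ)) →
  (∀ j → Favours s j (q (parity (num s κ j)))) →
  (∀ j → + c ℤ.* q (parity (num s κ j)) (unit j) ℤ.≤ q (not (parity (num s κ j))) (unit j)) →
  + (c ^ κ) ℤ.* q true (unit (elt s 0 z)) ℤ.≤ q true (unit (elt (not s) 0 z))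
inner-block-growth κ@(suc e) s z even c q add fav h = begin
  + (c * c ^ e) ℤ.* v 0 z           ≡⟨ cong (ℤ._* v 0 z) (ℤₚ.pos-* c (c ^ e)) ⟩
  + c ℤ.* + (c ^ e) ℤ.* v 0 z       ≡⟨ ℤₚ.*-assoc (+ c) (+ (c ^ e)) (v 0 z) ⟩
  + c ℤ.* (+ (c ^ e) ℤ.* v 0 z)     ≤⟨ ℤₚ.*-monoˡ-≤-nonNeg (+ c) (geometric c v step e ℕₚ.≤-refl z) ⟩
  -- The `κ − 1` steps between elements give `c ^ e`; the traversal inside the last element supplies
  -- the remaining factor.
  + c ℤ.* v e ℕₚ.≤-refl             ≤⟨ gain e ℕₚ.≤-refl ⟩
  q (not (parity κ)) (unit (elt s e ℕₚ.≤-refl))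
    -- As `κ` is even, the inner traversal at the last element starts with index 0 and so ends at
    -- the start for index 1.
    ≡⟨ cong₂ (λ σ j → q (not σ) (unit j)) (parity-even even) (elt-last s e ℕₚ.≤-refl z refl) ⟩
  q true (unit (elt (not s) 0 z))   ∎
  where
  open ℤₚ.≤-Reasoning
  v : ∀ n → .(n < κ) → ℤ
  -- `num` counts from 1, so rank `n` carries the index `parity (suc n)`, and rank 0 carries the
  -- index 1 of the statement.
  v n p = q (parity (suc n)) (unit (elt s n p))
  gain : ∀ n (p : n < κ) → + c ℤ.* v n p ℤ.≤ q (not (parity (suc n))) (unit (elt s n p))
  gain n p = subst (λ i → + c ℤ.* q (parity i) (unit (elt s n p)) ℤ.≤ q (not (parity i)) (unit (elt s n p)))
    (num-elt s n p) (h (elt s n p))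
  step : ∀ n (p : n < κ) (r : suc n < κ) → + c ℤ.* v n p ℤ.≤ v (suc n) r
  step n p r = begin
    + c ℤ.* v n p                                      ≤⟨ gain n p ⟩
    -- Consecutive ranks have opposite parity, so the inner traversal ends exactly where that of the
    -- next element starts. Passing to that element changes this block only.
    q (not (parity (suc n))) (unit (elt s n p))        ≡⟨ cong (λ σ → q σ (unit (elt s n p))) (parity-suc (suc n)) ⟨
    q (parity (suc (suc n))) (unit (elt s n p))        <⟨ favoured-exceeds (add _) fav′ (is (elt s n p)) below ⟩
    v (suc n) r                                        ∎
    where
    fav′ : Favours s (elt s (suc n) r) (q (parity (suc (suc n))))
    fav′ = subst (λ i → Favours s (elt s (suc n) r) (q (parity i))) (num-elt s (suc n) r) (fav (elt s (suc n) r))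
    below : ∀ i → is (elt s n p) i ≡ true → Precedes s i (elt s (suc n) r)
    below i eq with i Finₚ.≟ elt s n p
    ... | yes refl = before-elt s (suc n) r (elt s n p) (ℕₚ.≤-reflexive (num-elt s n p))

-- Unit vectors at the least element of K. Its first coordinate has position 1, which is odd, so
-- every later index is 1.
start : ∀ d {k} → (∀ i → 0 < k i) → Bool → Blocks d k
start zero    pos s = []
start (suc d) pos s = unit (elt s 0 (pos Fin.zero)) ▹ start d (pos ∘ Fin.suc) true

startK : ∀ d {k} → (∀ i → 0 < k i) → Bool → K d k
startK (suc d) pos s Fin.zero    = elt s 0 (pos Fin.zero)
startK (suc d) pos s (Fin.suc i) = startK d (pos ∘ Fin.suc) true i

start-leads : ∀ d k (pos : ∀ i → 0 < k i) s → Leads d k s (start d pos s) (startK d pos s)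
start-leads zero    k pos s = tt
start-leads (suc d) k pos s =
  block-leads s (elt s 0 (pos Fin.zero)) none (λ _ ())
  , subst (λ n → Leads d (k ∘ Fin.suc) (parity n) (start d (pos ∘ Fin.suc) true) (startK d (pos ∘ Fin.suc) true))
      (sym (num-elt s 0 (pos Fin.zero))) (start-leads d (k ∘ Fin.suc) (pos ∘ Fin.suc) true)

PositiveAtLeads : ∀ d k → Bool → (Blocks d k → ℤ) → Set
PositiveAtLeads d k s Q = ∀ t α → Leads d k s t α → + 0 ℤ.< Q t

-- As the kᵢ with i < d are even, the s-traversal of K ends where the (not s)-traversal starts.
traversal-growth : ∀ m k (pos : ∀ i → 0 < k i) → (∀ i → toℕ i < m → 2 ∣ k i) → 2 ≤ k (fromℕ m) →
  ∀ s (Q : Blocks (suc m) k → ℤ) → Multilinear (suc m) Q → PositiveAtLeads (suc m) k s Q →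
  + (2 ^ ((k (fromℕ m) ∸ 2) * prodFin m (k ∘ inject₁))) ℤ.* Q (start (suc m) pos s)
    ℤ.≤ Q (start (suc m) pos (not s))
traversal-growth zero k pos even 2≤k s Q (add , _) positive
  rewrite ℕₚ.*-identityʳ (k Fin.zero ∸ 2) =
  last-block-growth (k Fin.zero) s (pos Fin.zero) 2≤k (λ b → Q (b ▹ [])) (add [])
    (λ j B below → positive (block (is j) B ▹ []) (λ { Fin.zero → j }) (block-leads s j B below , tt))
traversal-growth (suc m) k pos even 2≤k s Q (add , lin) positive =
  subst (λ N → + N ℤ.* Q (start (suc (suc m)) pos s) ℤ.≤ Q (start (suc (suc m)) pos (not s))) exponent
    (inner-block-growth (k Fin.zero) s (pos Fin.zero) (even Fin.zero (s≤s z≤n)) (2 ^ E)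
      (λ σ b → Q (b ▹ start (suc m) pos′ σ)) (λ σ → add (start (suc m) pos′ σ)) favours growth)
  where
  k′   = k ∘ Fin.suc
  pos′ = pos ∘ Fin.suc
  E    = (k (Fin.suc (fromℕ m)) ∸ 2) * prodFin m (k′ ∘ inject₁)
  favours : ∀ j → Favours s j (λ b → Q (b ▹ start (suc m) pos′ (parity (num s (k Fin.zero) j))))
  favours j B below = positive _ (consK {k = k} j (startK (suc m) pos′ σ))
    (block-leads s j B below , start-leads (suc m) k′ pos′ σ)
    where σ = parity (num s (k Fin.zero) j)
  growth : ∀ j → let σ = parity (num s (k Fin.zero) j) in
    + (2 ^ E) ℤ.* Q (unit j ▹ start (suc m) pos′ σ) ℤ.≤ Q (unit j ▹ start (suc m) pos′ (not σ))
  -- With the first block fixed at `unit j`, the form in the other blocks is still multilinear, and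
  -- positive at leads for the index that `j` determines.
  growth j = traversal-growth m k′ pos′ (λ i i<m → even (Fin.suc i) (s≤s i<m)) 2≤k
    (parity (num s (k Fin.zero) j)) (λ t → Q (unit j ▹ t)) (lin (unit j))
    (λ t α lead → positive (unit j ▹ t) (consK {k = k} j α) (block-leads s j none (λ _ ()) , lead))
  exponent : (2 ^ E) ^ k Fin.zero ≡ 2 ^ ((k (Fin.suc (fromℕ m)) ∸ 2) * (k Fin.zero * prodFin m (k′ ∘ inject₁)))
  exponent = trans (ℕₚ.^-*-assoc 2 E (k Fin.zero)) (cong (2 ^_)
    (trans (ℕₚ.*-assoc (k (Fin.suc (fromℕ m)) ∸ 2) (prodFin m (k′ ∘ inject₁)) (k Fin.zero))
           (cong ((k (Fin.suc (fromℕ m)) ∸ 2) *_) (ℕₚ.*-comm (prodFin m (k′ ∘ inject₁)) (k Fin.zero)))))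

-- From growth to the degree and weight bounds

2^∸-bound : ∀ e d w → 2 ^ e ≤ 2 ^ d * w → 2 ^ (e ∸ d) ≤ w
2^∸-bound e       zero    w p = subst (2 ^ e ≤_) (ℕₚ.*-identityˡ w) p
-- Where the subtraction truncates, the claim is only that `w` is positive, and `w` equal to 0 would
-- contradict the hypothesis.
2^∸-bound zero    (suc d) zero    p = contradiction (subst (1 ≤_) (ℕₚ.*-zeroʳ (2 ^ suc d)) p) λ ()
2^∸-bound zero    (suc d) (suc w) p = s≤s z≤n
2^∸-bound (suc e) (suc d) w p = 2^∸-bound e d w (ℕₚ.*-cancelˡ-≤ 2 (subst (2 ^ suc e ≤_) (ℕₚ.*-assoc 2 (2 ^ d) w) p))

0<⇒n≤n*i : ∀ n i → + 0 ℤ.< i → + n ℤ.≤ + n ℤ.* i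
0<⇒n≤n*i n (+ suc i) _ = subst (+ n ℤ.≤_) (ℤₚ.pos-* n (suc i)) (ℤ.+≤+ (ℕₚ.m≤m*n n (suc i)))
0<⇒n≤n*i n (+ 0)     (ℤ.+<+ ())

+≤⇒≤∣∣ : ∀ {n i} → + n ℤ.≤ i → n ≤ ∣ i ∣
+≤⇒≤∣∣ (ℤ.+≤+ p) = p

all-positive : ∀ m (k : Fin (suc m) → ℕ) → (∀ i → toℕ i < m → 0 < k i) → 0 < k (fromℕ m) → ∀ i → 0 < k i
all-positive zero    k init last Fin.zero    = last
all-positive (suc m) k init last Fin.zero    = init Fin.zero (s≤s z≤n)
all-positive (suc m) k init last (Fin.suc i) =
  all-positive m (k ∘ Fin.suc) (λ j j<m → init (Fin.suc j) (s≤s j<m)) last i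

theorem3p2 : (m : ℕ) (k : Fin (suc m) → ℕ)
    → ((i : Fin (suc m)) → toℕ i < m → 2 ≤ k i × 2 ∣ k i)
    → 3 ≤ k (fromℕ m)
    → SignDegreeIs (F (suc m) k) (suc m)
    × WeightAtLeast (F (suc m) k) (suc m)
    (2 ^ ((k (fromℕ m) ∸ 2) * prodFin m (λ i → k (inject₁ i)) ∸ suc m))
theorem3p2 m k init last =
  ( (gate (suc m) k true , gate-isThresholdGate (suc m) k
      , MonosBelow⇒degree≤ (gate (suc m) k true) (gate-MonosBelow (suc m) k true))
  , degree-bound )
  , weight-bound
  where
  pos : ∀ i → 0 < k i
  pos = all-positive m k (λ i i<m → ℕₚ.<⇒≤ (proj₁ (init i i<m))) (ℕₚ.≤-trans (s≤s z≤n) last)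
  E = (k (fromℕ m) ∸ 2) * prodFin m (k ∘ inject₁)

  0<start : ∀ p → IsThresholdGate (F (suc m) k) p → + 0 ℤ.< gateSum p (start (suc m) pos true)
  0<start p isGate = 0<gateSum m k p isGate _ (startK (suc m) pos true) (start-leads (suc m) k pos true)

  degree-bound : ∀ p → IsThresholdGate (F (suc m) k) p → suc m ≤ degree p
  degree-bound p isGate with suc m ℕₚ.≤? degree p
  ... | yes le = le
  -- A gate of smaller degree would have alternating sum 0, against positivity at the start.
  ... | no ¬le = contradiction (0<start p isGate)
    (ℤₚ.<-irrefl (sym (gateSum-vanishes m p (ℕₚ.≤-pred (ℕₚ.≰⇒> ¬le)) (start (suc m) pos true))))

  weight-bound : ∀ p → IsThresholdGate (F (suc m) k) p → degree p ≤ suc m → 2 ^ (E ∸ suc m) ≤ weight p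
  weight-bound p isGate deg = 2^∸-bound E (suc m) (weight p) (ℕₚ.≤-trans (+≤⇒≤∣∣ large)
    (∣altSum∣≤ (suc m) (weight p) (λ t → eval p (flatten t)) (λ t → ∣eval∣≤weight p (flatten t)) (start (suc m) pos false)))
    where
    large : + (2 ^ E) ℤ.≤ gateSum p (start (suc m) pos false)
    -- The value at the start is a positive integer, hence at least 1, and grows by `2 ^ E` along
    -- the traversal.
    large = ℤₚ.≤-trans (0<⇒n≤n*i (2 ^ E) _ (0<start p isGate))
      (traversal-growth m k pos (λ i i<m → proj₂ (init i i<m)) (ℕₚ.<⇒≤ last) true
        (gateSum p) (gateSum-multilinear (suc m) p deg) (0<gateSum m k p isGate))
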